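{- Let $\mathcal{H}=\{rrr,bbr,yyb\}$. Then, for every positive integer $n$, $h_2(n,\mathcal{H})=\left\lceil \tfrac{3n}{7}\right\rceil+\epsilon_1(n)$, where $\epsilon_1(n)=1$ if $n\equiv 2\pmod 7$ and $\epsilon_1(n)=0$ otherwise.
   Context: Edge-colorings of the complete graph $K_n$ use colors from $\{r,b,y\}$ (red, blue, yellow); they need not be proper, and not all colors need be used. A pattern is an edge-colored triangle, denoted by the multiset of the colors of its three edges; e.g. $rrr$ is the all-red triangle, $bbr$ is the triangle with two blue edges and one red edge, and $yyb$ has two yellow edges and one blue edge. For a family $\mathcal{H}$ of patterns, $\operatorname{Forb}(n,\mathcal{H})$ is the set of all edge-colorings of $K_n$ with colors from $\{r,b,y\}$ in which no triangle has a coloring belonging to $\mathcal{H}$. For an edge-coloring $c$ of $K_n$, $h_2(c)$ is the maximum $k$ such that there is a set of $k$ vertices whose induced edges use at most two of the three colors. Finally, $h_2(n,\mathcal{H})=\min\{h_2(c): c\in\operatorname{Forb}(n,\mathcal{H})\}$. -}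

module Defs where

open import Data.Bool.Base using (if_then_else_)
open import Data.Fin.Base using (Fin)
open import Data.Fin.Subset using (Subset; _∈_; ∣_∣)
open import Data.Integer.Base as ℤ using (+_)
open import Data.List.Base using (List; []; _∷_)
open import Data.List.Membership.Propositional renaming (_∈_ to _∈ˡ_) using ()
open import Data.List.Relation.Binary.Permutation.Propositional using (_↭_)
open import Data.Nat.Base using (ℕ; _≤_; _%_; _≡ᵇ_; NonZero)
open import Data.Product.Base using (∃-syntax; _×_)
import Data.Rational.Unnormalised.Base as ℚᵘ
open import Data.Sum.Base using (_⊎_)
open import Data.Vec.Base using (Vec; []; _∷_; toList)
open import Relation.Binary.PropositionalEquality.Core using (_≡_; _≢_)
open import Relation.Nullary.Negation.Core using (¬_)

data Colour : Set where
  r b y : Colour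

-- The edges of Kₙ are the pairs of distinct vertices.  The values
-- colour i i are junk: nothing below ever inspects them.
record EdgeColouring (n : ℕ) : Set where
  field
    colour : Fin n → Fin n → Colour
    colour-sym : ∀ i j → colour i j ≡ colour j i

open EdgeColouring public

-- A pattern is a multiset of three colours: the order of the entries is
-- irrelevant, since patterns are only ever compared up to _↭_.
Pattern : Set
Pattern = Vec Colour 3

Family : Set
Family = List Pattern

HasPattern : ∀ {n} → EdgeColouring n → (i j k : Fin n) → Pattern → Set
HasPattern c i j k p =
  (colour c i j ∷ colour c j k ∷ colour c i k ∷ []) ↭ toList p

Forb : (n : ℕ) → Family → EdgeColouring n → Set
Forb n H c = ∀ (i j k : Fin n) → i ≢ j → j ≢ k → i ≢ k →
  ∀ p → p ∈ˡ H → ¬ HasPattern c i j k p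

-- The colours a and a′ are allowed to coincide.
AtMostTwoColours : ∀ {n} → EdgeColouring n → Subset n → Set
AtMostTwoColours c S = ∃[ a ] ∃[ a′ ]
  (∀ i j → i ∈ S → j ∈ S → i ≢ j → colour c i j ≡ a ⊎ colour c i j ≡ a′)

IsMaximum : (ℕ → Set) → ℕ → Set
IsMaximum P m = P m × (∀ k → P k → k ≤ m)

IsMinimum : (ℕ → Set) → ℕ → Set
IsMinimum P m = P m × (∀ k → P k → m ≤ k)

infix 4 h₂[_]≡_ h₂[_,_]≡_

-- The equation h₂(c) = m, as a relation.
h₂[_]≡_ : ∀ {n} → EdgeColouring n → ℕ → Set
h₂[_]≡_ {n} c m =
  IsMaximum (λ k → ∃[ S ] (∣ S ∣ ≡ k × AtMostTwoColours {n} c S)) m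

-- The equation h₂(n, H) = m, as a relation.  In particular it asserts that
-- Forb n H is inhabited.
h₂[_,_]≡_ : ℕ → Family → ℕ → Set
h₂[ n , H ]≡ m =
  IsMinimum (λ k → ∃[ c ] (Forb n H c × h₂[ c ]≡ k)) m

rrr-bbr-yyb : Family
rrr-bbr-yyb = (r ∷ r ∷ r ∷ []) ∷ (b ∷ b ∷ r ∷ []) ∷ (y ∷ y ∷ b ∷ []) ∷ []

⌈_/_⌉ : (m d : ℕ) .{{_ : NonZero d}} → ℕ
⌈ m / d ⌉ = ℤ.∣ ℚᵘ.ceiling ((+ m) ℚᵘ./ d) ∣

ε₁ : ℕ → ℕ
ε₁ n = if n % 7 ≡ᵇ 2 then 1 else 0

{-# OPTIONS --safe #-}

-- Lower bound.  If there is a blue triangle, then every vertex sends two red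
-- or two blue edges to it, and no two vertices of the same kind are joined by a
-- red edge: the vertices split into two red-free parts.  Otherwise consider a
-- shortest odd closed blue walk.  On it, vertices at distance 2 are joined by
-- yellow and at distance 3 by red edges, which rules out length 5; for length
-- at least 9 the colours from a fixed vertex would have to alternate between
-- red (odd distance) and yellow (even distance) all the way round, which an odd
-- length does not permit.  If there is none at all, the blue graph is bipartite
-- and the vertices split into two blue-free parts.  If its length is 7, it
-- carries the circulant colouring of ℤ/7 with ±1 blue, ±2 yellow and ±3 red,
-- every vertex is a twin of one of its vertices, and the whole colouring is a
-- blow-up with yellow classes.  There the triples {m - 1, m, m + 1} are red-free
-- and the triples {m - 2, m, m + 2} blue-free, and averaging over m concludes,
-- except that n = 7q + 2 needs an integrality argument.
--
-- Upper bound.  Balanced blow-ups of the same colouring are extremal: seven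
-- more vertices, one per class, add at most 3 to a two-coloured set.  The
-- exception is n = 4, where a proper colouring of K₄ is needed.

module Submission where

open import Defs
open import Data.Bool.Base using (Bool; true; false; _∨_; _xor_; if_then_else_)
open import Data.Bool.Properties using (xor-comm; xor-assoc; xor-same; xor-identityʳ; ¬-not; not-¬)
open import Data.Bool.Properties using () renaming (_≟_ to _≟ᵇ_)
open import Data.Empty using (⊥; ⊥-elim)
open import Data.Fin.Base using (Fin; zero; suc; toℕ; _↑ˡ_; _↑ʳ_; punchIn)
open import Data.Fin.Patterns
import Data.Fin.Properties as Fin
open import Data.Fin.Subset using (Subset; _∈_; ∣_∣; ∁; ⊤)
open import Data.Fin.Subset.Properties using (_∈?_; anySubset?; ∣∁p∣≡n∸∣p∣; x∈∁p⇒x∉p)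
import Data.Integer.Base as ℤ
import Data.Integer.Properties as ℤ
open import Data.List.Base using ([]; _∷_)
open import Data.List.Membership.Propositional using () renaming (_∈_ to _∈ˡ_)
open import Data.List.Relation.Binary.Permutation.Propositional using (_↭_; prep; swap; ↭-refl; ↭-trans)
open import Data.List.Relation.Binary.Permutation.Propositional.Properties using (map⁺)
open import Data.List.Relation.Unary.Any using (here; there)
open import Data.Nat.Base
open import Data.Nat.DivMod using (_divMod_; result; m/n≡1+[m∸n]/n; [m+kn]%n≡m%n)
open import Data.Nat.ListAction.Properties using (sum-↭)
open import Data.Nat.Properties
open import Data.Nat.Tactic.RingSolver using (solve-∀)
open import Algebra.Properties.Semiring.Sum +-*-semiring
  using (sum; sum-cong-≗; ∑-distrib-+; ∑-comm; *-distribˡ-sum; *-distribʳ-sum)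
open import Data.Sum.Base using (_⊎_; inj₁; inj₂)
open import Data.Vec.Base using (Vec; []; _∷_; lookup; toList; tabulate; _++_; splitAt; here; there)
open import Data.Vec.Properties using (lookup∘tabulate; []=⇒lookup; lookup⇒[]=)
open import Function.Base using (_∘_)
open import Relation.Binary.PropositionalEquality
open import Relation.Nullary
open import Relation.Nullary.Decidable using (False; toWitnessFalse)

-- With the pairing _,_ in scope, the notation h₂[ n , H ]≡ m would be ambiguous:
-- it is therefore opened in an anonymous module that ends before the theorem.
module _ where

  open import Data.Product.Base using (∃; ∃-syntax; _×_; _,_; proj₁; proj₂)

  -- Allowed triangles and the colouring of ℤ/7

  _≟ᶜ_ : (a a′ : Colour) → Dec (a ≡ a′)
  r ≟ᶜ r = yes refl
  r ≟ᶜ b = no λ ()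
  r ≟ᶜ y = no λ ()
  b ≟ᶜ r = no λ ()
  b ≟ᶜ b = yes refl
  b ≟ᶜ y = no λ ()
  y ≟ᶜ r = no λ ()
  y ≟ᶜ b = no λ ()
  y ≟ᶜ y = yes refl

  all-colours? : ∀ {ℓ} {P : Colour → Set ℓ} → (∀ a → Dec (P a)) → Dec (∀ a → P a)
  all-colours? P? = map′ (λ { (p , q , s) r → p ; (p , q , s) b → q ; (p , q , s) y → s }) (λ p → p r , p b , p y)
    (P? r ×-dec P? b ×-dec P? y)

  all-vectors? : ∀ {k ℓ} {P : Vec Colour k → Set ℓ} → (∀ v → Dec (P v)) → Dec (∀ v → P v)
  all-vectors? {zero} P? = map′ (λ { p [] → p }) (λ p → p []) (P? [])
  all-vectors? {suc k} P? = map′ (λ { p (a ∷ v) → p a v }) (λ p a v → p (a ∷ v))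
    (all-colours? λ a → all-vectors? λ v → P? (a ∷ v))

  -- A Boolean table over ordered triples lets the finite claims be decided by evaluation;
  -- permutations of patterns enter only in translating from and to `Forb`.
  forbidden : Colour → Colour → Colour → Bool
  forbidden r r r = true
  forbidden b b r = true
  forbidden b r b = true
  forbidden r b b = true
  forbidden y y b = true
  forbidden y b y = true
  forbidden b y y = true
  forbidden _ _ _ = false

  forbidden⇒pattern : ∀ a a′ a″ → forbidden a a′ a″ ≡ true →
    ∃[ p ] (p ∈ˡ rrr-bbr-yyb × (a ∷ a′ ∷ a″ ∷ []) ↭ toList p)
  forbidden⇒pattern r r r _ = _ , here refl , ↭-refl
  forbidden⇒pattern b b r _ = _ , there (here refl) , ↭-refl
  forbidden⇒pattern b r b _ = _ , there (here refl) , prep b (swap r b ↭-refl)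
  forbidden⇒pattern r b b _ = _ , there (here refl) , ↭-trans (swap r b ↭-refl) (prep b (swap r b ↭-refl))
  forbidden⇒pattern y y b _ = _ , there (there (here refl)) , ↭-refl
  forbidden⇒pattern y b y _ = _ , there (there (here refl)) , prep y (swap b y ↭-refl)
  forbidden⇒pattern b y y _ = _ , there (there (here refl)) , ↭-trans (swap b y ↭-refl) (prep y (swap b y ↭-refl))

  -- The weights 0, 1, 4 make the weight of a pattern determine it.
  weight : Colour → ℕ
  weight r = 0
  weight b = 1
  weight y = 4

  -- The numbers 0, 2 and 9 are the weights of rrr, bbr and yyb.
  weight-forbidden : ∀ a a′ a″ → let w = weight a + (weight a′ + (weight a″ + 0)) in
    w ≡ 0 ⊎ w ≡ 2 ⊎ w ≡ 9 → forbidden a a′ a″ ≡ true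
  weight-forbidden = from-yes (all-colours? λ a → all-colours? λ a′ → all-colours? λ a″ →
    let w = weight a + (weight a′ + (weight a″ + 0)) in
    (w ≟ 0 ⊎-dec w ≟ 2 ⊎-dec w ≟ 9) →-dec forbidden a a′ a″ ≟ᵇ true)

  pattern⇒forbidden : ∀ a a′ a″ p → p ∈ˡ rrr-bbr-yyb →
    (a ∷ a′ ∷ a″ ∷ []) ↭ toList p → forbidden a a′ a″ ≡ true
  pattern⇒forbidden a a′ a″ _ (here refl) a↭p =
    weight-forbidden a a′ a″ (inj₁ (sum-↭ (map⁺ weight a↭p)))
  pattern⇒forbidden a a′ a″ _ (there (here refl)) a↭p =
    weight-forbidden a a′ a″ (inj₂ (inj₁ (sum-↭ (map⁺ weight a↭p))))
  pattern⇒forbidden a a′ a″ _ (there (there (here refl))) a↭p =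
    weight-forbidden a a′ a″ (inj₂ (inj₂ (sum-↭ (map⁺ weight a↭p))))

  -- Distances d and 7 - d get the same colour. The value at 0 is yellow because twins in a blow-up
  -- are joined by yellow.
  circulant : ℕ → Colour
  circulant 0 = y
  circulant 1 = b
  circulant 2 = y
  circulant 3 = r
  circulant 4 = r
  circulant 5 = y
  circulant _ = b

  Z₇ : Fin 7 → Fin 7 → Colour
  Z₇ i j = circulant ∣ toℕ i - toℕ j ∣

  abstract
    -- Exhaustion over the 3^7 colour vectors from a vertex to the heptagon; it makes every vertex a
    -- twin of a heptagon vertex.
    Z₇-extension : ∀ (v : Vec Colour 7) →
      (∃[ i ] ∃[ j ] forbidden (lookup v i) (Z₇ i j) (lookup v j) ≡ true) ⊎ (∃[ i ] ∀ k → lookup v k ≡ Z₇ i k)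
    Z₇-extension = from-yes (all-vectors? λ v →
      (Fin.any? λ i → Fin.any? λ j → forbidden (lookup v i) (Z₇ i j) (lookup v j) ≟ᵇ true)
      ⊎-dec (Fin.any? λ i → Fin.all? λ k → lookup v k ≟ᶜ Z₇ i k))

    -- With `a` the colour between twins of `i` and `j`, the heptagon vertex `k` rules out every
    -- wrong value. For `i` equal to `j` this makes the classes yellow.
    Z₇-twins : ∀ i j a → a ≡ Z₇ i j ⊎ (∃[ k ] forbidden a (Z₇ j k) (Z₇ i k) ≡ true)
    Z₇-twins = from-yes (Fin.all? λ i → Fin.all? λ j → all-colours? λ a →
      a ≟ᶜ Z₇ i j ⊎-dec (Fin.any? λ k → forbidden a (Z₇ j k) (Z₇ i k) ≟ᵇ true))

    Z₇-allowed : ∀ i j k → forbidden (Z₇ i j) (Z₇ j k) (Z₇ i k) ≡ false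
    Z₇-allowed = from-yes (Fin.all? λ i → Fin.all? λ j → Fin.all? λ k →
      forbidden (Z₇ i j) (Z₇ j k) (Z₇ i k) ≟ᵇ false)

  -- Solving systems of equations over ℤ/2

  Solves : ∀ {n} → (Bool → Fin n → Fin n → Set) → (Fin n → Bool) → Set
  Solves D f = ∀ s u v → D s u v → f u xor f v ≡ s

  -- Elimination of the unknowns one after the other.  P stands for any family of
  -- equations that contains D and is closed under addition.
  xor-solve : ∀ {n} (D P : Bool → Fin n → Fin n → Set) →
    (∀ s u v → Dec (D s u v)) → (∀ {s u v} → D s u v → D s v u) →
    (∀ {s u v} → D s u v → P s u v) → (∀ {s t u v w} → P s u v → P t v w → P (s xor t) u w) →
    (∃ (Solves D)) ⊎ (∃[ v ] P true v v)
  xor-solve {zero} D P D? D-sym D⇒P P-trans = inj₁ ((λ ()) , λ { _ () })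
  xor-solve {suc n} D P D? D-sym D⇒P P-trans
    with D? true zero zero
  ... | yes d = inj₂ (zero , D⇒P d)
  ... | no ¬loop = extend (xor-solve D′ (λ s u v → P s (suc u) (suc v)) D′? D′-sym D′⇒P P-trans)
    where
    -- The equations without the unknown `zero`, together with the sums of any two that contain it.
    D′ : Bool → Fin n → Fin n → Set
    D′ s u v = D s (suc u) (suc v) ⊎ (∃[ t ] ∃[ t′ ] (t xor t′ ≡ s × D t (suc u) zero × D t′ zero (suc v)))

    any-Bool? : ∀ {Q : Bool → Set} → (∀ t → Dec (Q t)) → Dec (∃ Q)
    any-Bool? Q? = map′ (λ { (inj₁ q) → true , q ; (inj₂ q) → false , q })
      (λ { (true , q) → inj₁ q ; (false , q) → inj₂ q }) (Q? true ⊎-dec Q? false)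

    D′? : ∀ s u v → Dec (D′ s u v)
    D′? s u v = D? s (suc u) (suc v) ⊎-dec any-Bool? λ t → any-Bool? λ t′ →
      (t xor t′) ≟ᵇ s ×-dec D? t (suc u) zero ×-dec D? t′ zero (suc v)

    D′-sym : ∀ {s u v} → D′ s u v → D′ s v u
    D′-sym (inj₁ d) = inj₁ (D-sym d)
    D′-sym (inj₂ (t , t′ , eq , d , d′)) =
      inj₂ (t′ , t , trans (xor-comm t′ t) eq , D-sym d′ , D-sym d)

    D′⇒P : ∀ {s u v} → D′ s u v → P s (suc u) (suc v)
    D′⇒P (inj₁ d) = D⇒P d
    D′⇒P (inj₂ (t , t′ , refl , d , d′)) = P-trans (D⇒P d) (D⇒P d′)

    xor-cancel : ∀ a c s t → a xor c ≡ s xor t → a xor (c xor t) ≡ s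
    xor-cancel a c s t eq = begin
      a xor (c xor t)  ≡⟨ xor-assoc a c t ⟨
      (a xor c) xor t  ≡⟨ cong (_xor t) eq ⟩
      (s xor t) xor t  ≡⟨ xor-assoc s t t ⟩
      s xor (t xor t)  ≡⟨ cong (s xor_) (xor-same t) ⟩
      s xor false      ≡⟨ xor-identityʳ s ⟩
      s                ∎
      where open ≡-Reasoning

    extend : (∃ (Solves D′)) ⊎ (∃[ v ] P true (suc v) (suc v)) →
      (∃ (Solves D)) ⊎ (∃[ v ] P true v v)
    extend (inj₂ (v , p)) = inj₂ (suc v , p)
    extend (inj₁ (f , f-solves)) = inj₁ (g , g-solves)
      where
      neighbour? = Fin.any? λ u → any-Bool? λ t → D? t (suc u) zero

      g : Fin (suc n) → Bool
      g (suc u) = f u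
      g zero with neighbour?
      ... | yes (u , t , _) = f u xor t
      -- No equation links `zero` to another unknown, so any value will do.
      ... | no _ = false

      to-zero : ∀ {s u} → D s (suc u) zero → f u xor g zero ≡ s
      to-zero {s} {u} d with neighbour?
      -- The value at `zero` was read off from `u′`; the sum of the two equations belongs to `D′`,
      -- so `u` yields the same value.
      ... | yes (u′ , t , d′) = xor-cancel (f u) (f u′) s t
        (f-solves (s xor t) u u′ (inj₂ (s , t , refl , d , D-sym d′)))
      ... | no ¬nb = ⊥-elim (¬nb (u , s , d))

      g-solves : Solves D g
      g-solves s (suc u) (suc v) d = f-solves s u v (inj₁ d)
      g-solves s (suc u) zero d = to-zero d
      g-solves s zero (suc v) d = trans (xor-comm (g zero) (f v)) (to-zero (D-sym d))
      g-solves true zero zero d = ⊥-elim (¬loop d)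
      g-solves false zero zero d = xor-same (g zero)

  -- Blue walks

  majority-red : Vec Colour 3 → Bool
  majority-red (r ∷ r ∷ _ ∷ []) = true
  majority-red (r ∷ _ ∷ r ∷ []) = true
  majority-red (_ ∷ r ∷ r ∷ []) = true
  majority-red _ = false

  abstract
    -- The colours from a vertex to a blue triangle have a majority, red or blue,
    -- and two vertices with the same majority have a common neighbour of that colour.
    triangle-check : ∀ (u v : Vec Colour 3) → majority-red u ≢ majority-red v
      ⊎ (∃[ i ] ∃[ j ] (i ≢ j × forbidden (lookup u i) b (lookup u j) ≡ true))
      ⊎ (∃[ i ] ∃[ j ] (i ≢ j × forbidden (lookup v i) b (lookup v j) ≡ true))
      ⊎ (∃[ i ] forbidden r (lookup v i) (lookup u i) ≡ true)
    triangle-check = from-yes (all-vectors? λ u → all-vectors? λ v →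
      ¬? (majority-red u ≟ᵇ majority-red v) ⊎-dec clash? u ⊎-dec clash? v
      ⊎-dec Fin.any? λ i → forbidden r (lookup v i) (lookup u i) ≟ᵇ true)
      where
      clash? : ∀ (u : Vec Colour 3) → Dec (∃[ i ] ∃[ j ] (i ≢ j × forbidden (lookup u i) b (lookup u j) ≡ true))
      clash? u = Fin.any? λ i → Fin.any? λ j → ¬? (i Fin.≟ j) ×-dec forbidden (lookup u i) b (lookup u j) ≟ᵇ true

  module Structure {n : ℕ} (c : Fin n → Fin n → Colour) (c-sym : ∀ i j → c i j ≡ c j i)
    (c-diag : ∀ i → c i i ≡ y) (allowed : ∀ i j k → forbidden (c i j) (c j k) (c i k) ≡ false) where

    private variable
      j k : ℕ
      o p q u v w x : Fin n

    clash : ∀ u v w {a a′ a″} → c u v ≡ a → c v w ≡ a′ → c u w ≡ a″ → forbidden a a′ a″ ≡ true → ⊥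
    clash u v w refl refl refl bad with () ← trans (sym bad) (allowed u v w)

    flip : ∀ {a} → c u v ≡ a → c v u ≡ a
    flip {u} {v} eq = trans (c-sym v u) eq

    red : ∀ {a} → a ≢ b → a ≢ y → a ≡ r
    red {r} _ _ = refl
    red {b} ≢b _ = ⊥-elim (≢b refl)
    red {y} _ ≢y = ⊥-elim (≢y refl)

    yellow : ∀ {a} → a ≢ b → a ≢ r → a ≡ y
    yellow {r} _ ≢r = ⊥-elim (≢r refl)
    yellow {b} ≢b _ = ⊥-elim (≢b refl)
    yellow {y} _ _ = refl

    -- Lengths: EvenWalk k consists of 2k blue steps and OddClosed k of 2k + 1.
    data EvenWalk : ℕ → Fin n → Fin n → Set where
      []   : EvenWalk 0 u u
      step : c u v ≡ b → c v w ≡ b → EvenWalk k w x → EvenWalk (suc k) u x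

    infixr 5 _∙_
    _∙_ : EvenWalk j u v → EvenWalk k v w → EvenWalk (j + k) u w
    [] ∙ τ = τ
    step e e′ σ ∙ τ = step e e′ (σ ∙ τ)

    surround : c u v ≡ b → EvenWalk k v w → c w x ≡ b → EvenWalk (suc k) u x
    surround e [] e′ = step e e′ []
    surround e (step f f′ σ) e′ = step e f (surround f′ σ e′)

    -- Regroups the steps of an odd walk so that its single step comes first instead of last.
    shift : EvenWalk k u v → c v w ≡ b → ∃[ x ] (c u x ≡ b × EvenWalk k x w)
    shift [] e = _ , e , []
    shift (step f f′ σ) e = _ , f , surround f′ σ e

    evenWalk? : ∀ k u v → Dec (EvenWalk k u v)
    evenWalk? zero u v = map′ (λ { refl → [] }) (λ { [] → refl }) (u Fin.≟ v)
    evenWalk? (suc k) u x = map′ (λ { (_ , _ , e , e′ , σ) → step e e′ σ }) (λ { (step e e′ σ) → _ , _ , e , e′ , σ })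
      (Fin.any? λ v → Fin.any? λ w → c u v ≟ᶜ b ×-dec c v w ≟ᶜ b ×-dec evenWalk? k w x)

    OddClosed : ℕ → Fin n → Set
    OddClosed k v = ∃[ w ] (c v w ≡ b × EvenWalk k w v)

    oddClosed? : ∀ k v → Dec (OddClosed k v)
    oddClosed? k v = Fin.any? λ w → c v w ≟ᶜ b ×-dec evenWalk? k w v

    NoOddClosed : ℕ → Set
    NoOddClosed N = ∀ k v → k < N → ¬ OddClosed k v

    module _ {N : ℕ} (none : NoOddClosed N) (1<N : 1 < N) where

      -- Blue would close a blue triangle, and red would give the pattern bbr.
      distance-2 : c u v ≡ b → c v w ≡ b → c u w ≡ y
      distance-2 {u} {v} {w} uv vw = yellow
        (λ uw → none 1 u 1<N (w , uw , step (flip vw) (flip uv) []))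
        (λ uw → clash u v w uv vw uw refl)

      -- Blue would close `σ` to an odd walk that is too short. Yellow would give yyb on `u`, `w`,
      -- `x`, as `u` and `w` are at distance 2.
      distance-3 : c u v ≡ b → c v w ≡ b → c w x ≡ b → EvenWalk k x u → k < N → c u x ≡ r
      distance-3 {u} {v} {w} {x} uv vw wx σ k<N = red
        (λ ux → none _ u k<N (x , ux , σ))
        (λ ux → clash u w x (distance-2 uv vw) wx ux refl)

      -- On a shortest odd closed walk, x is red from o and at distances 3 + 2j and
      -- 6 + 2m from it.  Hence z, three steps further, is yellow from o, and a′, just
      -- before z, is red from o: march on from a′, until z is at distance 3 from o
      -- the other way round and so also red from o.
      march : ∀ m j → 3 + (m + j) < N → c o p ≡ b → EvenWalk (1 + j) p x → c o x ≡ r → EvenWalk (3 + m) x o → ⊥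
      march {o} {p} {x} m j <N op px ox (step {v = a} {w = a′} xa aa′ (step {v = z} a′z zz′ z′o)) = continue m <N refl z′o
        where
        oz-walk : EvenWalk (2 + (j + 1)) o z
        oz-walk = surround op px xa ∙ step aa′ a′z []

        j+3<N : 2 + (j + 1) < N
        j+3<N = ≤-<-trans (s≤s (s≤s (≤-trans (≤-reflexive (+-comm j 1)) (s≤s (m≤n+m j m))))) <N

        -- The rest of the closed walk leads from `z` through `o` and `p` back to `x`.
        xz : c x z ≡ r
        xz = distance-3 xa aa′ a′z (surround zz′ z′o op ∙ px)
          (≤-<-trans (≤-reflexive (cong (2 +_) (+-suc m j))) <N)

        oz≢b : c o z ≢ b
        oz≢b oz = none _ z j+3<N (o , flip oz , oz-walk)

        oz : c o z ≡ y
        oz = yellow oz≢b (λ oz → clash o x z ox xz oz refl)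

        oa′ : c o a′ ≡ r
        oa′ = red
          (λ oa′ → none (2 + m) o (≤-<-trans (s≤s (s≤s (≤-trans (m≤m+n m j) (n≤1+n _)))) <N)
              (a′ , oa′ , step a′z zz′ z′o))
          (λ oa′ → clash o a′ z oa′ a′z oz refl)

        continue : ∀ l → 3 + (l + j) < N → l ≡ m → EvenWalk (1 + l) _ o → ⊥
        continue zero _ _ (step z′w wo [])
          with () ← trans (sym oz) (flip (distance-3 zz′ z′w wo oz-walk j+3<N))
        continue (suc l) <N refl _ = march l (suc j)
          (≤-<-trans (≤-reflexive (cong (3 +_) (+-suc l j))) <N) op
          (subst (λ k → EvenWalk k p a′) (+-comm (1 + j) 1) (px ∙ step xa aa′ []))
          oa′ (step a′z zz′ z′o)

    -- Induction on the length, with lengths 3 and 7 excluded by hypothesis. Guarding the latter by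
    -- `3 < N` makes it vacuous for `N` equal to 3, which serves to show that a closed walk of
    -- length 7 is a shortest one.
    no-odd-closed : (∀ v → ¬ OddClosed 1 v) → ∀ N → (∀ v → 3 < N → ¬ OddClosed 3 v) → NoOddClosed N
    no-odd-closed ¬1 (suc N) ¬3 k v k<1+N closed with m<1+n⇒m<n∨m≡n k<1+N
    ... | inj₁ k<N = no-odd-closed ¬1 N (λ v 3<N → ¬3 v (m<n⇒m<1+n 3<N)) k v k<N closed
    ... | inj₂ refl = shortest k (λ v 3≡k → ¬3 v (s≤s (≤-reflexive 3≡k)))
      (no-odd-closed ¬1 k (λ v 3<k → ¬3 v (m<n⇒m<1+n 3<k))) closed
      where
      shortest : ∀ k {v} → (∀ v → 3 ≡ k → ¬ OddClosed 3 v) → NoOddClosed k → ¬ OddClosed k v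
      shortest 0 {v} _ _ (_ , loop , []) with () ← trans (sym loop) (c-diag v)
      shortest 1 _ _ closed = ¬1 _ closed
      -- In a blue pentagon `o`, `p`, `q`, `s`, `t` the triangle `o`, `q`, `s` has the pattern yyb.
      shortest 2 {o} _ none (p , op , step {v = q} {w = s} pq qs (step st to [])) =
        clash o q s (distance-2 none (s≤s (s≤s z≤n)) op pq) qs (flip (distance-2 none (s≤s (s≤s z≤n)) st to)) refl
      shortest 3 ¬3 _ closed = ¬3 _ refl closed
      shortest (suc (suc (suc (suc k)))) _ none (p , op , step pq qx xo) =
        march none (s≤s (s≤s z≤n)) k 0 (s≤s (s≤s (s≤s (s≤s (≤-reflexive (+-identityʳ k)))))) op (step pq qx [])
          (distance-3 none (s≤s (s≤s z≤n)) op pq qx xo ≤-refl) xo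

    -- The blue heptagon

    Heptagon : Set
    Heptagon = ∃ λ (φ : Fin 7 → Fin n) → ∀ i j → c (φ i) (φ j) ≡ Z₇ i j

    heptagon : NoOddClosed 3 → ∀ {v} → OddClosed 3 v → Heptagon
    heptagon none {v₀} (v₁ , e₀ , step {v = v₂} {w = v₃} e₁ e₂ (step {v = v₄} {w = v₅} e₃ e₄ (step {v = v₆} e₅ e₆ []))) =
      φ , colours
      where
      φ : Fin 7 → Fin n
      φ = lookup (v₀ ∷ v₁ ∷ v₂ ∷ v₃ ∷ v₄ ∷ v₅ ∷ v₆ ∷ [])

      d₂ : c o p ≡ b → c p q ≡ b → c o q ≡ y
      d₂ = distance-2 none (s≤s (s≤s z≤n))

      d₃ : ∀ {o p q s t u v} → c o p ≡ b → c p q ≡ b → c q s ≡ b →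
          c s t ≡ b → c t u ≡ b → c u v ≡ b → c v o ≡ b → c o s ≡ r
      d₃ e f g h h′ h″ h‴ = distance-3 none (s≤s (s≤s z≤n)) e f g (step h h′ (step h″ h‴ [])) ≤-refl

      colours : ∀ i j → c (φ i) (φ j) ≡ Z₇ i j
      colours 0F 0F = c-diag _
      colours 0F 1F = e₀
      colours 0F 2F = d₂ e₀ e₁
      colours 0F 3F = d₃ e₀ e₁ e₂ e₃ e₄ e₅ e₆
      colours 0F 4F = flip (d₃ e₄ e₅ e₆ e₀ e₁ e₂ e₃)
      colours 0F 5F = flip (d₂ e₅ e₆)
      colours 0F 6F = flip e₆
      colours 1F 0F = flip e₀
      colours 1F 1F = c-diag _
      colours 1F 2F = e₁
      colours 1F 3F = d₂ e₁ e₂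
      colours 1F 4F = d₃ e₁ e₂ e₃ e₄ e₅ e₆ e₀
      colours 1F 5F = flip (d₃ e₅ e₆ e₀ e₁ e₂ e₃ e₄)
      colours 1F 6F = flip (d₂ e₆ e₀)
      colours 2F 0F = flip (d₂ e₀ e₁)
      colours 2F 1F = flip e₁
      colours 2F 2F = c-diag _
      colours 2F 3F = e₂
      colours 2F 4F = d₂ e₂ e₃
      colours 2F 5F = d₃ e₂ e₃ e₄ e₅ e₆ e₀ e₁
      colours 2F 6F = flip (d₃ e₆ e₀ e₁ e₂ e₃ e₄ e₅)
      colours 3F 0F = flip (d₃ e₀ e₁ e₂ e₃ e₄ e₅ e₆)
      colours 3F 1F = flip (d₂ e₁ e₂)
      colours 3F 2F = flip e₂
      colours 3F 3F = c-diag _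
      colours 3F 4F = e₃
      colours 3F 5F = d₂ e₃ e₄
      colours 3F 6F = d₃ e₃ e₄ e₅ e₆ e₀ e₁ e₂
      colours 4F 0F = d₃ e₄ e₅ e₆ e₀ e₁ e₂ e₃
      colours 4F 1F = flip (d₃ e₁ e₂ e₃ e₄ e₅ e₆ e₀)
      colours 4F 2F = flip (d₂ e₂ e₃)
      colours 4F 3F = flip e₃
      colours 4F 4F = c-diag _
      colours 4F 5F = e₄
      colours 4F 6F = d₂ e₄ e₅
      colours 5F 0F = d₂ e₅ e₆
      colours 5F 1F = d₃ e₅ e₆ e₀ e₁ e₂ e₃ e₄
      colours 5F 2F = flip (d₃ e₂ e₃ e₄ e₅ e₆ e₀ e₁)
      colours 5F 3F = flip (d₂ e₃ e₄)
      colours 5F 4F = flip e₄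
      colours 5F 5F = c-diag _
      colours 5F 6F = e₅
      colours 6F 0F = e₆
      colours 6F 1F = d₂ e₆ e₀
      colours 6F 2F = d₃ e₆ e₀ e₁ e₂ e₃ e₄ e₅
      colours 6F 3F = flip (d₃ e₃ e₄ e₅ e₆ e₀ e₁ e₂)
      colours 6F 4F = flip (d₂ e₄ e₅)
      colours 6F 5F = flip e₅
      colours 6F 6F = c-diag _

    -- Global structure of the colouring

    Bipartite : Colour → Set
    Bipartite e = ∃ λ (f : Fin n → Bool) → ∀ u v → c u v ≡ e → f u ≢ f v

    BlowUp : Set
    BlowUp = ∃ λ (f : Fin n → Fin 7) → ∀ u v → c u v ≡ Z₇ (f u) (f v)

    blue-triangle⇒red-bipartite : OddClosed 1 v → Bipartite r
    blue-triangle⇒red-bipartite {v₀} (v₁ , e₀ , step {v = v₂} e₁ e₂ []) = majority-red ∘ profile , cut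
      where
      t : Fin 3 → Fin n
      t = lookup (v₀ ∷ v₁ ∷ v₂ ∷ [])

      t-blue : ∀ i j → i ≢ j → c (t i) (t j) ≡ b
      t-blue 0F 0F i≢j = ⊥-elim (i≢j refl)
      t-blue 0F 1F _ = e₀
      t-blue 0F 2F _ = flip e₂
      t-blue 1F 0F _ = flip e₀
      t-blue 1F 1F i≢j = ⊥-elim (i≢j refl)
      t-blue 1F 2F _ = e₁
      t-blue 2F 0F _ = e₂
      t-blue 2F 1F _ = flip e₁
      t-blue 2F 2F i≢j = ⊥-elim (i≢j refl)

      profile : Fin n → Vec Colour 3
      profile u = tabulate (c u ∘ t)

      colour-to : ∀ u i → c u (t i) ≡ lookup (profile u) i
      colour-to u i = sym (lookup∘tabulate (c u ∘ t) i)

      profile-clash : ∀ u → ¬ (∃[ i ] ∃[ j ] (i ≢ j × forbidden (lookup (profile u) i) b (lookup (profile u) j) ≡ true))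
      profile-clash u (i , j , i≢j , bad) = clash u (t i) (t j) (colour-to u i) (t-blue i j i≢j) (colour-to u j) bad

      cut : ∀ u v → c u v ≡ r → majority-red (profile u) ≢ majority-red (profile v)
      cut u v uv same with triangle-check (profile u) (profile v)
      ... | inj₁ differ = differ same
      ... | inj₂ (inj₁ u-clash) = profile-clash u u-clash
      ... | inj₂ (inj₂ (inj₁ v-clash)) = profile-clash v v-clash
      ... | inj₂ (inj₂ (inj₂ (i , bad))) = clash u v (t i) uv (colour-to v i) (colour-to u i) bad

    heptagon⇒blow-up : Heptagon → BlowUp
    heptagon⇒blow-up (φ , φ-Z₇) = class , class-colour
      where
      profile : Fin n → Vec Colour 7
      profile u = tabulate (c u ∘ φ)

      colour-to : ∀ u i → c u (φ i) ≡ lookup (profile u) i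
      colour-to u i = sym (lookup∘tabulate (c u ∘ φ) i)

      twin : ∀ u → ∃[ i ] ∀ k → c u (φ k) ≡ Z₇ i k
      twin u with Z₇-extension (profile u)
      ... | inj₁ (i , j , bad) = ⊥-elim (clash u (φ i) (φ j) (colour-to u i) (φ-Z₇ i j) (colour-to u j) bad)
      ... | inj₂ (i , eq) = i , λ k → trans (colour-to u k) (eq k)

      class : Fin n → Fin 7
      class = proj₁ ∘ twin

      class-colour : ∀ u v → c u v ≡ Z₇ (class u) (class v)
      class-colour u v with Z₇-twins (class u) (class v) (c u v)
      ... | inj₁ eq = eq
      ... | inj₂ (k , bad) = ⊥-elim (clash u v (φ k) refl (proj₂ (twin v) k) (proj₂ (twin u) k) bad)

    -- A bipartition solves the equations `f u xor f v ≡ true` over the blue edges. Sums of these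
    -- equations are witnessed by walks of the corresponding parity, so an inconsistency is an odd
    -- closed walk.
    no-odd-closed⇒blue-bipartite : (∀ k v → ¬ OddClosed k v) → Bipartite b
    no-odd-closed⇒blue-bipartite none with xor-solve Blue Walk Blue? Blue-sym Blue⇒Walk (λ {s} {t} → Walk-trans s t)
      where
      Blue : Bool → Fin n → Fin n → Set
      Blue s u v = s ≡ true × c u v ≡ b

      Blue? : ∀ s u v → Dec (Blue s u v)
      Blue? s u v = s ≟ᵇ true ×-dec c u v ≟ᶜ b

      Blue-sym : ∀ {s u v} → Blue s u v → Blue s v u
      Blue-sym (s≡true , uv) = s≡true , flip uv

      Walk : Bool → Fin n → Fin n → Set
      Walk false u w = ∃[ k ] EvenWalk k u w
      Walk true u w = ∃[ k ] ∃[ v ] (c u v ≡ b × EvenWalk k v w)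

      Blue⇒Walk : ∀ {s u v} → Blue s u v → Walk s u v
      Blue⇒Walk (refl , uv) = _ , _ , uv , []

      Walk-trans : ∀ s t {u v w} → Walk s u v → Walk t v w → Walk (s xor t) u w
      Walk-trans false false (_ , σ) (_ , τ) = _ , σ ∙ τ
      Walk-trans false true (_ , σ) (_ , _ , e , τ) with _ , e′ , σ′ ← shift σ e = _ , _ , e′ , σ′ ∙ τ
      Walk-trans true false (_ , _ , e , σ) (_ , τ) = _ , _ , e , σ ∙ τ
      Walk-trans true true (_ , _ , e , σ) (_ , _ , e′ , τ) = _ , surround e σ e′ ∙ τ
    ... | inj₂ (v , k , w , e , σ) = ⊥-elim (none k v (w , e , σ))
    ... | inj₁ (f , solves) = f , λ u v uv fu≡fv →
      true≢false (trans (sym (solves true u v (refl , uv))) (trans (cong (f u xor_) (sym fu≡fv)) (xor-same (f u))))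
      where
      true≢false : true ≢ false
      true≢false ()

    structure : Bipartite r ⊎ Bipartite b ⊎ BlowUp
    structure with Fin.any? (oddClosed? 1)
    ... | yes (_ , triangle) = inj₁ (blue-triangle⇒red-bipartite triangle)
    ... | no ¬1 with Fin.any? (oddClosed? 3)
    ...   | no ¬3 = inj₂ (inj₁ (no-odd-closed⇒blue-bipartite λ k v →
              no-odd-closed (λ v p → ¬1 (v , p)) (suc k) (λ v _ p → ¬3 (v , p)) k v ≤-refl))
    ...   | yes (_ , closed) = inj₂ (inj₂ (heptagon⇒blow-up (heptagon shorter closed)))
      where
      shorter : NoOddClosed 3
      shorter = no-odd-closed (λ v p → ¬1 (v , p)) 3 λ { _ (s≤s (s≤s (s≤s ()))) }

  -- The value of the ceiling

  -- The ceiling unfolds to minus the floor of the negative, and the absolute value drops the outer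
  -- sign.
  ⌈m/7⌉≡∣-m/7∣ : ∀ m → ⌈ m / 7 ⌉ ≡ ℤ.∣ (ℤ.- (ℤ.+ m)) ℤ./ℕ 7 ∣
  ⌈m/7⌉≡∣-m/7∣ m = trans (ℤ.∣-i∣≡∣i∣ ((ℤ.- (ℤ.+ m)) ℤ./ (ℤ.+ 7))) (cong ℤ.∣_∣ (ℤ.*-identityˡ ((ℤ.- (ℤ.+ m)) ℤ./ℕ 7)))

  ⌈[7+m]/7⌉≡1+⌈m/7⌉ : ∀ m → ⌈ 7 + m / 7 ⌉ ≡ suc ⌈ m / 7 ⌉
  ⌈[7+m]/7⌉≡1+⌈m/7⌉ zero = refl
  ⌈[7+m]/7⌉≡1+⌈m/7⌉ (suc m) = trans (⌈m/7⌉≡∣-m/7∣ (8 + m)) (trans step (cong suc (sym (⌈m/7⌉≡∣-m/7∣ (suc m)))))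
    where
    next : (8 + m) / 7 ≡ suc (suc m / 7)
    next = m/n≡1+[m∸n]/n {8 + m} {7} (m≤m+n 7 (suc m))

    step : ℤ.∣ ℤ.-[1+ 7 + m ] ℤ./ℕ 7 ∣ ≡ suc ℤ.∣ ℤ.-[1+ m ] ℤ./ℕ 7 ∣
    -- Division of a negative integer branches on the remainder. Those of `8 + m` and `suc m` reduce
    -- to the same term, so one split serves both sides.
    step with suc m % 7
    ... | zero = trans (ℤ.∣-i∣≡∣i∣ (ℤ.+ ((8 + m) / 7))) (trans next (cong suc (sym (ℤ.∣-i∣≡∣i∣ (ℤ.+ (suc m / 7))))))
    ... | suc _ = cong suc next

  ⌈[k*7+m]/7⌉≡k+⌈m/7⌉ : ∀ k m → ⌈ k * 7 + m / 7 ⌉ ≡ k + ⌈ m / 7 ⌉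
  ⌈[k*7+m]/7⌉≡k+⌈m/7⌉ zero m = refl
  ⌈[k*7+m]/7⌉≡k+⌈m/7⌉ (suc k) m = trans (⌈[7+m]/7⌉≡1+⌈m/7⌉ (k * 7 + m)) (cong suc (⌈[k*7+m]/7⌉≡k+⌈m/7⌉ k m))

  -- The claimed value for each residue, with the exceptional 1 at residue 2 included.
  quota : Fin 7 → ℕ
  quota 0F = 0
  quota 1F = 1
  quota 2F = 2
  quota 3F = 2
  quota 4F = 2
  quota 5F = 3
  quota 6F = 3

  closed-form : ∀ q s → ⌈ 3 * (q * 7 + toℕ s) / 7 ⌉ + ε₁ (q * 7 + toℕ s) ≡ q * 3 + quota s
  closed-form q s = begin
    ⌈ 3 * (q * 7 + toℕ s) / 7 ⌉ + ε₁ (q * 7 + toℕ s)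
      ≡⟨ cong₂ _+_ (cong (⌈_/ 7 ⌉) (regroup q (toℕ s))) (cong (λ m → if m ≡ᵇ 2 then 1 else 0) period) ⟩
    ⌈ q * 3 * 7 + 3 * toℕ s / 7 ⌉ + ε₁ (toℕ s)        ≡⟨ cong (_+ ε₁ (toℕ s)) (⌈[k*7+m]/7⌉≡k+⌈m/7⌉ (q * 3) (3 * toℕ s)) ⟩
    q * 3 + ⌈ 3 * toℕ s / 7 ⌉ + ε₁ (toℕ s)            ≡⟨ +-assoc (q * 3) _ _ ⟩
    q * 3 + (⌈ 3 * toℕ s / 7 ⌉ + ε₁ (toℕ s))          ≡⟨ cong (q * 3 +_) (residue s) ⟩
    q * 3 + quota s                                    ∎
    where
    open ≡-Reasoning
    regroup : ∀ q s → 3 * (q * 7 + s) ≡ q * 3 * 7 + 3 * s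
    regroup = solve-∀

    period : (q * 7 + toℕ s) % 7 ≡ toℕ s % 7
    period = trans (cong (_% 7) (+-comm (q * 7) (toℕ s))) ([m+kn]%n≡m%n (toℕ s) q 7)

    residue : ∀ s → ⌈ 3 * toℕ s / 7 ⌉ + ε₁ (toℕ s) ≡ quota s
    residue 0F = refl
    residue 1F = refl
    residue 2F = refl
    residue 3F = refl
    residue 4F = refl
    residue 5F = refl
    residue 6F = refl

  -- Class sizes of a blow-up

  𝟙 : Bool → ℕ
  𝟙 t = if t then 1 else 0

  δ : ∀ {k} → Fin k → Fin k → ℕ
  δ i j = 𝟙 (does (i Fin.≟ j))

  sum-mono-≤ : ∀ {k} {f g : Fin k → ℕ} → (∀ i → f i ≤ g i) → sum f ≤ sum g
  sum-mono-≤ {zero} _ = z≤n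
  sum-mono-≤ {suc k} f≤g = +-mono-≤ (f≤g zero) (sum-mono-≤ (f≤g ∘ suc))

  dot : ∀ {k} → (Fin k → ℕ) → (Fin k → ℕ) → ℕ
  dot f g = sum λ i → f i * g i

  dot-congˡ : ∀ {k} {f f′ : Fin k → ℕ} (g : Fin k → ℕ) → (∀ i → f i ≡ f′ i) → dot f g ≡ dot f′ g
  dot-congˡ g f≗f′ = sum-cong-≗ λ i → cong (_* g i) (f≗f′ i)

  dot-+ˡ : ∀ {k} (f f′ g : Fin k → ℕ) → dot (λ i → f i + f′ i) g ≡ dot f g + dot f′ g
  dot-+ˡ f f′ g = trans (sum-cong-≗ λ i → *-distribʳ-+ (g i) (f i) (f′ i)) (∑-distrib-+ (λ i → f i * g i) (λ i → f′ i * g i))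

  dot-+ʳ : ∀ {k} (f g g′ : Fin k → ℕ) → dot f (λ i → g i + g′ i) ≡ dot f g + dot f g′
  dot-+ʳ f g g′ = trans (sum-cong-≗ λ i → *-distribˡ-+ (f i) (g i) (g′ i)) (∑-distrib-+ (λ i → f i * g i) (λ i → f i * g′ i))

  dot-constˡ : ∀ {k} a (g : Fin k → ℕ) → dot (λ _ → a) g ≡ a * sum g
  dot-constˡ a g = sym (*-distribˡ-sum a g)

  dot-zeroʳ : ∀ {k} (f : Fin k → ℕ) → dot f (λ _ → 0) ≡ 0
  dot-zeroʳ f = trans (sym (*-distribʳ-sum 0 f)) (*-zeroʳ (sum f))

  dot-δʳ : ∀ {k} (f : Fin k → ℕ) i → dot f (δ i) ≡ f i
  dot-δʳ f zero = trans (cong₂ _+_ (*-identityʳ (f zero)) (dot-zeroʳ (f ∘ suc))) (+-identityʳ (f zero))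
  dot-δʳ f (suc i) = trans (cong (_+ dot (f ∘ suc) (δ i)) (*-zeroʳ (f zero))) (dot-δʳ (f ∘ suc) i)

  dot-δˡ : ∀ {k} i (g : Fin k → ℕ) → dot (δ i) g ≡ g i
  dot-δˡ i g = trans (sum-cong-≗ λ j → *-comm (δ i j) (g j)) (dot-δʳ g i)

  sum-dot : ∀ {k l} (f : Fin l → Fin k → ℕ) (g : Fin k → ℕ) → sum (λ m → dot (f m) g) ≡ dot (λ i → sum λ m → f m i) g
  sum-dot f g = trans (∑-comm λ m i → f m i * g i) (sum-cong-≗ λ i → sym (*-distribʳ-sum (g i) λ m → f m i))

  ∣tabulate∣ : ∀ {n} (g : Fin (suc n) → Bool) → ∣ tabulate g ∣ ≡ 𝟙 (g zero) + ∣ tabulate (g ∘ suc) ∣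
  ∣tabulate∣ g with g zero
  ... | true = refl
  ... | false = refl

  class-size : ∀ {n k} → (Fin n → Fin k) → Fin k → ℕ
  class-size f i = ∣ tabulate (λ x → does (f x Fin.≟ i)) ∣

  -- Each vertex adds `δ` of its class to the class sizes; sizes of unions of classes thus become
  -- linear forms.
  ∣tabulate∣≡dot-class-size : ∀ {n k} (f : Fin n → Fin k) (T : Fin k → Bool) →
    ∣ tabulate (T ∘ f) ∣ ≡ dot (𝟙 ∘ T) (class-size f)
  ∣tabulate∣≡dot-class-size {zero} f T = sym (dot-zeroʳ (𝟙 ∘ T))
  ∣tabulate∣≡dot-class-size {suc n} f T = begin
    ∣ tabulate (T ∘ f) ∣  ≡⟨ ∣tabulate∣ (T ∘ f) ⟩
    𝟙 (T (f zero)) + ∣ tabulate (T ∘ f ∘ suc) ∣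
      ≡⟨ cong₂ _+_ (sym (dot-δʳ (𝟙 ∘ T) (f zero))) (∣tabulate∣≡dot-class-size (f ∘ suc) T) ⟩
    dot (𝟙 ∘ T) (δ (f zero)) + dot (𝟙 ∘ T) (class-size (f ∘ suc))
      ≡⟨ dot-+ʳ (𝟙 ∘ T) (δ (f zero)) (class-size (f ∘ suc)) ⟨
    dot (𝟙 ∘ T) (λ i → δ (f zero) i + class-size (f ∘ suc) i)
      ≡⟨ sum-cong-≗ (λ i → cong (𝟙 (T i) *_) (∣tabulate∣ (λ x → does (f x Fin.≟ i)))) ⟨
    dot (𝟙 ∘ T) (class-size f) ∎
    where open ≡-Reasoning

  ∣tabulate-true∣ : ∀ n → ∣ tabulate {n = n} (λ _ → true) ∣ ≡ n
  ∣tabulate-true∣ zero = refl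
  ∣tabulate-true∣ (suc n) = cong suc (∣tabulate-true∣ n)

  sum-class-size : ∀ {n k} (f : Fin n → Fin k) → sum (class-size f) ≡ n
  sum-class-size {n} f = begin
    sum (class-size f)             ≡⟨ *-identityˡ _ ⟨
    1 * sum (class-size f)         ≡⟨ dot-constˡ 1 (class-size f) ⟨
    dot (λ _ → 1) (class-size f)   ≡⟨ ∣tabulate∣≡dot-class-size f (λ _ → true) ⟨
    ∣ tabulate {n = n} (λ _ → true) ∣      ≡⟨ ∣tabulate-true∣ n ⟩
    n ∎
    where open ≡-Reasoning

  -- Large two-coloured triples of classes

  -- The triples {m - 1, m, m + 1} and {m - 2, m, m + 2} of ℤ/7.
  red-free blue-free : Fin 7 → Fin 7 → Bool
  red-free m i = does (m Fin.≟ i) ∨ does (Z₇ m i ≟ᶜ b)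
  blue-free m i = does (Z₇ m i ≟ᶜ y)

  abstract
    red-free-avoids : ∀ m i j → red-free m i ≡ true → red-free m j ≡ true → Z₇ i j ≢ r
    red-free-avoids = from-yes (Fin.all? λ m → Fin.all? λ i → Fin.all? λ j →
      red-free m i ≟ᵇ true →-dec red-free m j ≟ᵇ true →-dec ¬? (Z₇ i j ≟ᶜ r))

    blue-free-avoids : ∀ m i j → blue-free m i ≡ true → blue-free m j ≡ true → Z₇ i j ≢ b
    blue-free-avoids = from-yes (Fin.all? λ m → Fin.all? λ i → Fin.all? λ j →
      blue-free m i ≟ᵇ true →-dec blue-free m j ≟ᵇ true →-dec ¬? (Z₇ i j ≟ᶜ b))

    each-in-3-red-free : ∀ i → sum (λ m → 𝟙 (red-free m i)) ≡ 3
    each-in-3-red-free = from-yes (Fin.all? λ i → sum (λ m → 𝟙 (red-free m i)) ≟ 3)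

    -- The six points other than `i` are consecutive in ℤ/7 and split into two blocks of three.
    complement-of-point : ∀ i → ∃[ m ] ∃[ m′ ] ∀ l → 𝟙 (red-free m l) + 𝟙 (red-free m′ l) + δ i l ≡ 1
    complement-of-point = from-yes (Fin.all? λ i → Fin.any? λ m → Fin.any? λ m′ → Fin.all? λ l →
      𝟙 (red-free m l) + 𝟙 (red-free m′ l) + δ i l ≟ 1)

    -- Differences 1 and 2 occur in consecutive triples, and difference 3 occurs between m - 2 and m
    -- + 2.
    pair-in-triple : ∀ i j → i ≢ j → ∃[ k ] ∃[ m ] ((∀ l → 𝟙 (red-free m l) ≡ δ i l + δ j l + δ k l)
                                            ⊎ (∀ l → 𝟙 (blue-free m l) ≡ δ i l + δ j l + δ k l))
    pair-in-triple = from-yes (Fin.all? λ i → Fin.all? λ j → ¬? (i Fin.≟ j) →-dec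
      (Fin.any? λ k → Fin.any? λ m → (Fin.all? λ l → 𝟙 (red-free m l) ≟ δ i l + δ j l + δ k l)
                            ⊎-dec (Fin.all? λ l → 𝟙 (blue-free m l) ≟ δ i l + δ j l + δ k l)))

    sum-δ : ∀ (i : Fin 7) → sum (δ i) ≡ 1
    sum-δ = from-yes (Fin.all? λ (i : Fin 7) → sum (δ i) ≟ 1)

    -- This says that `quota s` is at most 3s/7 rounded up; it fails at 2, where 13 ≤ 14.
    average-bound : ∀ s → s ≢ 2F → ¬ 7 + 3 * toℕ s ≤ 7 * quota s
    average-bound = from-yes (Fin.all? λ s → ¬? (s Fin.≟ 2F) →-dec ¬? (7 + 3 * toℕ s ≤? 7 * quota s))

  LargeTriple : ℕ → (Fin 7 → ℕ) → Set
  LargeTriple k ν = (∃[ m ] k ≤ dot (𝟙 ∘ red-free m) ν) ⊎ (∃[ m ] k ≤ dot (𝟙 ∘ blue-free m) ν)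

  -- Every class lies in three of the seven triples, so their sizes add up to 3n and some triple
  -- reaches 3n/7 rounded up.
  average : ∀ q s ν → s ≢ 2F → sum ν ≡ q * 7 + toℕ s →
    ¬ (∀ m → dot (𝟙 ∘ red-free m) ν < q * 3 + quota s)
  average q s ν s≢2 total small = average-bound s s≢2 (+-cancelˡ-≤ (q * 21) _ _ (begin
    q * 21 + (7 + 3 * toℕ s)                      ≡⟨ regroup q (toℕ s) ⟩
    7 + 3 * (q * 7 + toℕ s)                       ≡⟨ cong (λ t → 7 + 3 * t) total ⟨
    7 + 3 * sum ν                                  ≡⟨ cong (7 +_) (dot-constˡ 3 ν) ⟨
    7 + dot (λ _ → 3) ν                            ≡⟨ cong (7 +_) (dot-congˡ ν each-in-3-red-free) ⟨
    7 + dot (λ i → sum λ m → 𝟙 (red-free m i)) ν  ≡⟨ cong (7 +_) (sum-dot (λ m → 𝟙 ∘ red-free m) ν) ⟨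
    7 + sum (λ m → dot (𝟙 ∘ red-free m) ν)        ≡⟨ ∑-distrib-+ {7} (λ _ → 1) (λ m → dot (𝟙 ∘ red-free m) ν) ⟨
    sum (λ m → suc (dot (𝟙 ∘ red-free m) ν))      ≤⟨ sum-mono-≤ small ⟩
    sum {7} (λ _ → q * 3 + quota s)                ≡⟨ regroup′ q (quota s) ⟩
    q * 21 + 7 * quota s                           ∎))
    where
    open ≤-Reasoning
    regroup : ∀ q s → q * 21 + (7 + 3 * s) ≡ 7 + 3 * (q * 7 + s)
    regroup = solve-∀
    regroup′ : ∀ q u → 7 * (q * 3 + u) ≡ q * 21 + 7 * u
    regroup′ = solve-∀

  -- Rounding the average up does not suffice for n = 7q + 2.  There, if all the
  -- triples had at most 3q + 1 elements, then every class would have at least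
  -- q elements, and at most one class would have more, namely q + 1.
  no-small-triples : ∀ q ν → sum ν ≡ q * 7 + 2 →
    (∀ m → dot (𝟙 ∘ red-free m) ν < q * 3 + 2) → ¬ (∀ m → dot (𝟙 ∘ blue-free m) ν < q * 3 + 2)
  no-small-triples q ν total red-small blue-small = 1+n≰n (begin
    suc (q * 7 + 1)  ≡⟨ +-suc (q * 7) 1 ⟨
    q * 7 + 2        ≡⟨ total ⟨
    sum ν            ≤⟨ sum≤ ⟩
    q * 7 + 1        ∎)
    where
    open ≤-Reasoning

    q≤ν : ∀ i → q ≤ ν i
    q≤ν i with complement-of-point i
    -- Removing two triples of at most 3q + 1 vertices each from 7q + 2 leaves at least q.
    ... | m , m′ , partition = +-cancelˡ-≤ (2 * (q * 3 + 2)) q (ν i) (begin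
      2 * (q * 3 + 2) + q                        ≡⟨ regroup q ⟩
      2 + (q * 7 + 2)                            ≡⟨ cong (2 +_) total ⟨
      2 + sum ν                                  ≡⟨ cong (2 +_) (*-identityˡ (sum ν)) ⟨
      2 + 1 * sum ν                              ≡⟨ cong (2 +_) (dot-constˡ 1 ν) ⟨
      2 + dot (λ _ → 1) ν                        ≡⟨ cong (2 +_) (dot-congˡ ν partition) ⟨
      2 + dot (λ l → 𝟙 (red-free m l) + 𝟙 (red-free m′ l) + δ i l) ν
        ≡⟨ cong (2 +_) (dot-+ˡ (λ l → 𝟙 (red-free m l) + 𝟙 (red-free m′ l)) (δ i) ν) ⟩
      2 + (dot (λ l → 𝟙 (red-free m l) + 𝟙 (red-free m′ l)) ν + dot (δ i) ν)
        ≡⟨ cong (2 +_) (cong₂ _+_ (dot-+ˡ (𝟙 ∘ red-free m) (𝟙 ∘ red-free m′) ν) (dot-δˡ i ν)) ⟩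
      2 + (dot (𝟙 ∘ red-free m) ν + dot (𝟙 ∘ red-free m′) ν + ν i)
        ≡⟨ regroup′ (dot (𝟙 ∘ red-free m) ν) _ (ν i) ⟩
      suc (dot (𝟙 ∘ red-free m) ν) + (suc (dot (𝟙 ∘ red-free m′) ν) + 0) + ν i
        ≤⟨ +-monoˡ-≤ (ν i) (+-mono-≤ (red-small m) (+-monoˡ-≤ 0 (red-small m′))) ⟩
      2 * (q * 3 + 2) + ν i                      ∎)
      where
      regroup : ∀ q → 2 * (q * 3 + 2) + q ≡ 2 + (q * 7 + 2)
      regroup = solve-∀
      regroup′ : ∀ u v w → 2 + (u + v + w) ≡ suc u + (suc v + 0) + w
      regroup′ = solve-∀

    pair≤ : ∀ {i j} → i ≢ j → ν i + ν j ≤ q * 2 + 1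
    pair≤ {i} {j} i≢j with pair-in-triple i j i≢j
    -- The triple has at most 3q + 1 vertices, at least q of them in class `k`.
    ... | k , m , triple = +-cancelʳ-≤ q (ν i + ν j) (q * 2 + 1) (s≤s⁻¹ (begin
      suc (ν i + ν j + q)    ≤⟨ s≤s (+-monoʳ-≤ (ν i + ν j) (q≤ν k)) ⟩
      suc (ν i + ν j + ν k)  ≤⟨ bound triple ⟩
      q * 3 + 2              ≡⟨ regroup q ⟩
      suc (q * 2 + 1 + q)    ∎))
      where
      regroup : ∀ q → q * 3 + 2 ≡ suc (q * 2 + 1 + q)
      regroup = solve-∀

      size : ∀ {T : Fin 7 → Bool} → (∀ l → 𝟙 (T l) ≡ δ i l + δ j l + δ k l) → dot (𝟙 ∘ T) ν ≡ ν i + ν j + ν k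
      size {T} eq = trans (dot-congˡ ν eq) (trans (dot-+ˡ (λ l → δ i l + δ j l) (δ k) ν)
        (cong₂ _+_ (trans (dot-+ˡ (δ i) (δ j) ν) (cong₂ _+_ (dot-δˡ i ν) (dot-δˡ j ν))) (dot-δˡ k ν)))

      bound : _ → ν i + ν j + ν k < q * 3 + 2
      bound (inj₁ eq) = subst (_< q * 3 + 2) (size eq) (red-small m)
      bound (inj₂ eq) = subst (_< q * 3 + 2) (size eq) (blue-small m)

    sum≤ : sum ν ≤ q * 7 + 1
    sum≤ with Fin.any? (λ i → q <? ν i)
    ... | no none = begin
      sum ν              ≤⟨ sum-mono-≤ (λ i → ≮⇒≥ (λ q<ν → none (i , q<ν))) ⟩
      sum {7} (λ _ → q)  ≡⟨ *-comm 7 q ⟩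
      q * 7              ≤⟨ m≤m+n (q * 7) 1 ⟩
      q * 7 + 1          ∎
    ... | yes (i , q<νi) = begin
      sum ν                      ≤⟨ sum-mono-≤ ν≤ ⟩
      sum (λ j → q + δ i j)      ≡⟨ ∑-distrib-+ (λ _ → q) (δ i) ⟩
      7 * q + sum (δ i)          ≡⟨ cong₂ _+_ (*-comm 7 q) (sum-δ i) ⟩
      q * 7 + 1                  ∎
      where
      ν≤ : ∀ j → ν j ≤ q + δ i j
      ν≤ j with i Fin.≟ j
      -- The class `punchIn i 0F` is an arbitrary one other than `i`; its q or more vertices leave
      -- at most q + 1 for `i`.
      ... | yes refl = +-cancelʳ-≤ q (ν i) (q + 1) (begin
        ν i + q               ≤⟨ +-monoʳ-≤ (ν i) (q≤ν (punchIn i 0F)) ⟩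
        ν i + ν (punchIn i 0F)  ≤⟨ pair≤ (Fin.punchInᵢ≢i i 0F ∘ sym) ⟩
        q * 2 + 1             ≡⟨ regroup q ⟩
        q + 1 + q             ∎)
        where
        regroup : ∀ q → q * 2 + 1 ≡ q + 1 + q
        regroup = solve-∀
      ... | no i≢j = +-cancelˡ-≤ (suc q) (ν j) (q + 0) (begin
        suc q + ν j    ≤⟨ +-monoˡ-≤ (ν j) q<νi ⟩
        ν i + ν j      ≤⟨ pair≤ i≢j ⟩
        q * 2 + 1      ≡⟨ regroup q ⟩
        suc q + (q + 0) ∎)
        where
        regroup : ∀ q → q * 2 + 1 ≡ suc q + (q + 0)
        regroup = solve-∀

  large-triple : ∀ q s ν → sum ν ≡ q * 7 + toℕ s → LargeTriple (q * 3 + quota s) ν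
  large-triple q s ν total
    with Fin.any? (λ m → q * 3 + quota s ≤? dot (𝟙 ∘ red-free m) ν)
       | Fin.any? (λ m → q * 3 + quota s ≤? dot (𝟙 ∘ blue-free m) ν)
  ... | yes large | _ = inj₁ large
  ... | no _ | yes large = inj₂ large
  ... | no ¬red | no ¬blue with s Fin.≟ 2F
  ...   | no s≢2 = ⊥-elim (average q s ν s≢2 total λ m → ≰⇒> λ le → ¬red (m , le))
  ...   | yes refl = ⊥-elim (no-small-triples q ν total (λ m → ≰⇒> λ le → ¬red (m , le)) (λ m → ≰⇒> λ le → ¬blue (m , le)))

  -- Lower bound

  -- With three colours, missing one amounts to using at most two; both bounds are proved in this
  -- form.
  Avoids : ∀ {n} → EdgeColouring n → Colour → Subset n → Set
  Avoids c e S = ∀ i j → i ∈ S → j ∈ S → i ≢ j → colour c i j ≢ e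

  other-colours : ∀ (e : Colour) → ∃[ a ] ∃[ a′ ] ∀ x → x ≢ e → x ≡ a ⊎ x ≡ a′
  other-colours r = b , y , λ { r ≢ → ⊥-elim (≢ refl) ; b _ → inj₁ refl ; y _ → inj₂ refl }
  other-colours b = r , y , λ { b ≢ → ⊥-elim (≢ refl) ; r _ → inj₁ refl ; y _ → inj₂ refl }
  other-colours y = r , b , λ { y ≢ → ⊥-elim (≢ refl) ; r _ → inj₁ refl ; b _ → inj₂ refl }

  unused-colour : ∀ (a a′ : Colour) → ∃[ e ] (a ≢ e × a′ ≢ e)
  unused-colour r r = b , (λ ()) , λ ()
  unused-colour r b = y , (λ ()) , λ ()
  unused-colour r y = b , (λ ()) , λ ()
  unused-colour b r = y , (λ ()) , λ ()
  unused-colour b b = r , (λ ()) , λ ()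
  unused-colour b y = r , (λ ()) , λ ()
  unused-colour y r = b , (λ ()) , λ ()
  unused-colour y b = r , (λ ()) , λ ()
  unused-colour y y = r , (λ ()) , λ ()

  avoids⇒two-colours : ∀ {n} (c : EdgeColouring n) e {S} → Avoids c e S → AtMostTwoColours c S
  avoids⇒two-colours c e avoids with a , a′ , complete ← other-colours e =
    a , a′ , λ i j i∈S j∈S i≢j → complete _ (avoids i j i∈S j∈S i≢j)

  two-colours⇒avoids : ∀ {n} (c : EdgeColouring n) {S} → AtMostTwoColours c S → ∃[ e ] Avoids c e S
  two-colours⇒avoids c {S} (a , a′ , two) with e , a≢e , a′≢e ← unused-colour a a′ = e , avoids
    where
    avoids : Avoids c e S
    avoids i j i∈S j∈S i≢j ij≡e with two i j i∈S j∈S i≢j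
    ... | inj₁ ij≡a = a≢e (trans (sym ij≡a) ij≡e)
    ... | inj₂ ij≡a′ = a′≢e (trans (sym ij≡a′) ij≡e)

  ∈-tabulate : ∀ {n} (f : Fin n → Bool) {i} → i ∈ tabulate f → f i ≡ true
  ∈-tabulate f {i} i∈ = trans (sym (lookup∘tabulate f i)) ([]=⇒lookup i∈)

  module Lower {n : ℕ} (c : EdgeColouring n) (forb : Forb n rrr-bbr-yyb c) where

    -- With the diagonal made yellow, degenerate triangles are allowed too.
    colour° : Fin n → Fin n → Colour
    colour° i j = if does (i Fin.≟ j) then y else colour c i j

    colour°-diag : ∀ i → colour° i i ≡ y
    colour°-diag i with i Fin.≟ i
    ... | yes _ = refl
    ... | no i≢i = ⊥-elim (i≢i refl)

    colour°-edge : ∀ {i j} → i ≢ j → colour° i j ≡ colour c i j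
    colour°-edge {i} {j} i≢j with i Fin.≟ j
    ... | yes i≡j = ⊥-elim (i≢j i≡j)
    ... | no _ = refl

    colour°-sym : ∀ i j → colour° i j ≡ colour° j i
    colour°-sym i j with i Fin.≟ j
    ... | yes refl = sym (colour°-diag i)
    ... | no i≢j = trans (colour-sym c i j) (sym (colour°-edge (i≢j ∘ sym)))

    yaa-allowed : ∀ a → forbidden y a a ≡ false
    yaa-allowed r = refl
    yaa-allowed b = refl
    yaa-allowed y = refl

    aya-allowed : ∀ a → forbidden a y a ≡ false
    aya-allowed r = refl
    aya-allowed b = refl
    aya-allowed y = refl

    aay-allowed : ∀ a → forbidden a a y ≡ false
    aay-allowed r = refl
    aay-allowed b = refl
    aay-allowed y = refl

    allowed : ∀ i j k → forbidden (colour° i j) (colour° j k) (colour° i k) ≡ false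
    allowed i j k with i Fin.≟ j
    ... | yes refl = yaa-allowed (colour° i k)
    ... | no i≢j with j Fin.≟ k
    ...   | yes refl = trans (cong (forbidden (colour c i j) y) (colour°-edge i≢j)) (aya-allowed (colour c i j))
    ...   | no j≢k with i Fin.≟ k
    ...     | yes refl = trans (cong (λ a → forbidden (colour c i j) a y) (colour-sym c j i)) (aay-allowed (colour c i j))
    ...     | no i≢k = ¬-not λ bad →
                let p , p∈H , pattern-p = forbidden⇒pattern _ _ _ bad in forb i j k i≢j j≢k i≢k p p∈H pattern-p

    open Structure colour° colour°-sym colour°-diag allowed

    Large : ℕ → Set
    Large k = ∃[ e ] ∃[ S ] (k ≤ ∣ S ∣ × Avoids c e S)

    -- The larger side has at least n/2 vertices, rounded up, and the hypothesis bounds `k` by this.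
    bipartite⇒large : ∀ {e} → Bipartite e → ∀ k → k + k ≤ suc n → Large k
    bipartite⇒large {e} (f , cut) k 2k≤1+n with k ≤? ∣ tabulate f ∣
    ... | yes k≤ = e , tabulate f , k≤ , λ i j i∈ j∈ i≢j ij≡e →
            cut i j (trans (colour°-edge i≢j) ij≡e) (trans (∈-tabulate f i∈) (sym (∈-tabulate f j∈)))
    ... | no k≰ = e , ∁ (tabulate f) , k≤ , λ i j i∈ j∈ i≢j ij≡e →
            cut i j (trans (colour°-edge i≢j) ij≡e) (trans (outside i∈) (sym (outside j∈)))
      where
      outside : ∀ {i} → i ∈ ∁ (tabulate f) → f i ≡ false
      outside {i} i∈ = ¬-not λ fi → x∈∁p⇒x∉p i∈ (lookup⇒[]= i (tabulate f) (trans (lookup∘tabulate f i) fi))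

      k≤ : k ≤ ∣ ∁ (tabulate f) ∣
      k≤ = subst (k ≤_) (sym (∣∁p∣≡n∸∣p∣ (tabulate f)))
        (m+n≤o⇒m≤o∸n k (s≤s⁻¹ (≤-trans (≤-reflexive (sym (+-suc k _))) (≤-trans (+-monoʳ-≤ k (≰⇒> k≰)) 2k≤1+n))))

    blow-up⇒large : BlowUp → ∀ q s → n ≡ q * 7 + toℕ s → Large (q * 3 + quota s)
    blow-up⇒large (f , f-Z₇) q s n≡ with large-triple q s (class-size f) (trans (sum-class-size f) n≡)
    ... | inj₁ (m , le) = r , tabulate (red-free m ∘ f) , subst (_ ≤_) (sym (∣tabulate∣≡dot-class-size f (red-free m))) le ,
      λ i j i∈ j∈ i≢j ij → red-free-avoids m (f i) (f j) (∈-tabulate (red-free m ∘ f) i∈) (∈-tabulate (red-free m ∘ f) j∈)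
        (trans (sym (f-Z₇ i j)) (trans (colour°-edge i≢j) ij))
    ... | inj₂ (m , le) = b , tabulate (blue-free m ∘ f) , subst (_ ≤_) (sym (∣tabulate∣≡dot-class-size f (blue-free m))) le ,
      λ i j i∈ j∈ i≢j ij → blue-free-avoids m (f i) (f j) (∈-tabulate (blue-free m ∘ f) i∈) (∈-tabulate (blue-free m ∘ f) j∈)
        (trans (sym (f-Z₇ i j)) (trans (colour°-edge i≢j) ij))

    structure⇒large : ∀ q s → n ≡ q * 7 + toℕ s → (q * 3 + quota s) + (q * 3 + quota s) ≤ suc n → Large (q * 3 + quota s)
    structure⇒large q s n≡ half with structure
    ... | inj₁ red-cut = bipartite⇒large red-cut _ half
    ... | inj₂ (inj₁ blue-cut) = bipartite⇒large blue-cut _ half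
    ... | inj₂ (inj₂ blow-up) = blow-up⇒large blow-up q s n≡

  -- The claimed value exceeds n/2 rounded up only for n = 2.
  half-suffices : ∀ q s → ¬ (q ≡ 0 × s ≡ 2F) → (q * 3 + quota s) + (q * 3 + quota s) ≤ suc (q * 7 + toℕ s)
  half-suffices q s ≢2 = begin
    (q * 3 + quota s) + (q * 3 + quota s) ≡⟨ regroup q (quota s) ⟩
    q * 6 + (quota s + quota s)           ≤⟨ +-monoʳ-≤ (q * 6) (quota-bound q s ≢2) ⟩
    q * 6 + (q + suc (toℕ s))             ≡⟨ regroup′ q (toℕ s) ⟩
    suc (q * 7 + toℕ s)                   ∎
    where
    open ≤-Reasoning
    regroup : ∀ q u → (q * 3 + u) + (q * 3 + u) ≡ q * 6 + (u + u)
    regroup = solve-∀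
    regroup′ : ∀ q s → q * 6 + (q + suc s) ≡ suc (q * 7 + s)
    regroup′ = solve-∀

    quota-bound : ∀ q s → ¬ (q ≡ 0 × s ≡ 2F) → quota s + quota s ≤ q + suc (toℕ s)
    quota-bound zero 2F ≢2 = ⊥-elim (≢2 (refl , refl))
    quota-bound (suc q) 2F _ = s≤s (m≤n+m 3 q)
    quota-bound q 0F _ = z≤n
    quota-bound q 1F _ = m≤n+m 2 q
    quota-bound q 3F _ = m≤n+m 4 q
    quota-bound q 4F _ = ≤-trans (n≤1+n 4) (m≤n+m 5 q)
    quota-bound q 5F _ = m≤n+m 6 q
    quota-bound q 6F _ = ≤-trans (n≤1+n 6) (m≤n+m 7 q)

  lower-bound : ∀ q s (c : EdgeColouring (q * 7 + toℕ s)) → Forb _ rrr-bbr-yyb c →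
    ∃[ e ] ∃[ S ] (q * 3 + quota s ≤ ∣ S ∣ × Avoids c e S)
  lower-bound q s c forb with q ≟ 0 ×-dec s Fin.≟ 2F
  ... | no ≢2 = Lower.structure⇒large c forb q s refl (half-suffices q s ≢2)
  -- For n = 2 the only edge has one colour, so both vertices are taken.
  ... | yes (refl , refl) with e , ≢e , _ ← unused-colour (colour c 0F 1F) (colour c 0F 1F) = e , ⊤ , ≤-refl , avoids
    where
    avoids : Avoids c e ⊤
    avoids 0F 0F _ _ 0≢0 _ = 0≢0 refl
    avoids 0F 1F _ _ _ = ≢e
    avoids 1F 0F _ _ _ 10≡e = ≢e (trans (colour-sym c 0F 1F) 10≡e)
    avoids 1F 1F _ _ 1≢1 _ = 1≢1 refl

  -- Upper bound

  allowed⇒forb : ∀ {n} (c : EdgeColouring n) →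
    (∀ i j k → forbidden (colour c i j) (colour c j k) (colour c i k) ≡ false) → Forb n rrr-bbr-yyb c
  allowed⇒forb c allowed i j k _ _ _ p p∈H pattern-p =
    not-¬ (allowed i j k) (pattern⇒forbidden _ _ _ p p∈H pattern-p)

  Bounded : ∀ {n} → EdgeColouring n → ℕ → Set
  Bounded c k = ∀ e S → Avoids c e S → ∣ S ∣ ≤ k

  exceeds? : ∀ {n} (c : EdgeColouring n) k → Dec (∃[ S ] (k < ∣ S ∣ × ∃[ e ] Avoids c e S))
  exceeds? c k = anySubset? λ S → k <? ∣ S ∣ ×-dec any-colour? λ e →
    Fin.all? λ i → Fin.all? λ j → i ∈? S →-dec j ∈? S →-dec ¬? (i Fin.≟ j) →-dec ¬? (colour c i j ≟ᶜ e)
    where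
    any-colour? : ∀ {P : Colour → Set} → (∀ a → Dec (P a)) → Dec (∃ P)
    any-colour? P? = map′ (λ { (inj₁ p) → r , p ; (inj₂ (inj₁ p)) → b , p ; (inj₂ (inj₂ p)) → y , p })
      (λ { (r , p) → inj₁ p ; (b , p) → inj₂ (inj₁ p) ; (y , p) → inj₂ (inj₂ p) })
      (P? r ⊎-dec P? b ⊎-dec P? y)

  -- Exhaustive search over subsets and missing colours; at concrete arguments the last hypothesis
  -- evaluates to the unit type.
  bounded : ∀ {n} (c : EdgeColouring n) k → False (exceeds? c k) → Bounded c k
  bounded c k none e S avoids = ≮⇒≥ λ k< → toWitnessFalse none (S , k< , e , avoids)

  -- The order of the classes is chosen so that, for s ≠ 4, no two-coloured set
  -- contains more than quota s of the first s classes.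
  class : ℕ → Fin 7
  class 0 = 0F
  class 1 = 4F
  class 2 = 5F
  class 3 = 1F
  class 4 = 2F
  class 5 = 3F
  class 6 = 6F
  class (suc (suc (suc (suc (suc (suc (suc n))))))) = class n

  Z₇-sym : ∀ i j → Z₇ i j ≡ Z₇ j i
  Z₇-sym i j = cong circulant (∣-∣-comm (toℕ i) (toℕ j))

  blow-up : ∀ n → EdgeColouring n
  blow-up n .colour i j = Z₇ (class (toℕ i)) (class (toℕ j))
  blow-up n .colour-sym i j = Z₇-sym (class (toℕ i)) (class (toℕ j))

  blow-up-forb : ∀ n → Forb n rrr-bbr-yyb (blow-up n)
  blow-up-forb n = allowed⇒forb (blow-up n) λ i j k → Z₇-allowed (class (toℕ i)) (class (toℕ j)) (class (toℕ k))

  -- The three perfect matchings are the colour classes, so every triangle shows all three colours.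
  -- The diagonal is yellow.
  K₄ : Fin 4 → Fin 4 → Colour
  K₄ i j = lookup (lookup ((y ∷ r ∷ b ∷ y ∷ []) ∷ (r ∷ y ∷ y ∷ b ∷ []) ∷ (b ∷ y ∷ y ∷ r ∷ []) ∷ (y ∷ b ∷ r ∷ y ∷ []) ∷ []) i) j

  abstract
    bounded-base : ∀ s → s ≢ 4F → Bounded (blow-up (toℕ s)) (quota s)
    bounded-base 0F _ = bounded (blow-up 0) 0 _
    bounded-base 1F _ = bounded (blow-up 1) 1 _
    bounded-base 2F _ = bounded (blow-up 2) 2 _
    bounded-base 3F _ = bounded (blow-up 3) 2 _
    bounded-base 4F 4≢4 = ⊥-elim (4≢4 refl)
    bounded-base 5F _ = bounded (blow-up 5) 3 _
    bounded-base 6F _ = bounded (blow-up 6) 3 _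

    bounded-7 : Bounded (blow-up 7) 3
    bounded-7 = bounded (blow-up 7) 3 _

    -- Extending `blow-up 4` by seven vertices would only give 6, since its classes 0, 1, 4 form a
    -- two-coloured triple. For residue 4 the induction therefore starts here.
    bounded-11 : Bounded (blow-up 11) 5
    bounded-11 = bounded (blow-up 11) 5 _

    K₄-sym : ∀ i j → K₄ i j ≡ K₄ j i
    K₄-sym = from-yes (Fin.all? λ i → Fin.all? λ j → K₄ i j ≟ᶜ K₄ j i)

    K₄-allowed : ∀ i j k → forbidden (K₄ i j) (K₄ j k) (K₄ i k) ≡ false
    K₄-allowed = from-yes (Fin.all? λ i → Fin.all? λ j → Fin.all? λ k →
      forbidden (K₄ i j) (K₄ j k) (K₄ i k) ≟ᵇ false)

  K₄-colouring : EdgeColouring 4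
  K₄-colouring .colour = K₄
  K₄-colouring .colour-sym = K₄-sym

  bounded-K₄ : Bounded K₄-colouring 2
  bounded-K₄ = bounded K₄-colouring 2 _

  ∣++∣ : ∀ {m n} (A : Subset m) (B : Subset n) → ∣ A ++ B ∣ ≡ ∣ A ∣ + ∣ B ∣
  ∣++∣ [] B = refl
  ∣++∣ (true ∷ A) B = cong suc (∣++∣ A B)
  ∣++∣ (false ∷ A) B = ∣++∣ A B

  ∈-++ˡ : ∀ {m n} {A : Subset m} (B : Subset n) {i} → i ∈ A → i ↑ˡ n ∈ A ++ B
  ∈-++ˡ B here = here
  ∈-++ˡ B (there i∈A) = there (∈-++ˡ B i∈A)

  ∈-++ʳ : ∀ {m n} (A : Subset m) {B : Subset n} {i} → i ∈ B → m ↑ʳ i ∈ A ++ B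
  ∈-++ʳ [] i∈B = i∈B
  ∈-++ʳ (_ ∷ A) i∈B = there (∈-++ʳ A i∈B)

  -- The first seven vertices, one per class, contribute at most 3. Since `class` has period 7 by
  -- definition, the others again carry `blow-up n`.
  bounded-7+ : ∀ {n k} → Bounded (blow-up n) k → Bounded (blow-up (7 + n)) (3 + k)
  bounded-7+ {n} {k} tail-bound e S avoids with splitAt 7 S
  ... | A , B , refl = ≤-trans (≤-reflexive (∣++∣ A B)) (+-mono-≤ (bounded-7 e A avoidsˡ) (tail-bound e B avoidsʳ))
    where
    avoidsˡ : Avoids (blow-up 7) e A
    avoidsˡ i j i∈A j∈A i≢j ij≡e = avoids (i ↑ˡ n) (j ↑ˡ n) (∈-++ˡ B i∈A) (∈-++ˡ B j∈A)
      (i≢j ∘ Fin.↑ˡ-injective n i j)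
      (trans (cong₂ (λ u v → Z₇ (class u) (class v)) (Fin.toℕ-↑ˡ i n) (Fin.toℕ-↑ˡ j n)) ij≡e)

    avoidsʳ : Avoids (blow-up n) e B
    avoidsʳ i j i∈B j∈B i≢j = avoids (7 ↑ʳ i) (7 ↑ʳ j) (∈-++ʳ A i∈B) (∈-++ʳ A j∈B) (i≢j ∘ Fin.↑ʳ-injective 7 i j)

  bounded-blow-up : ∀ q s → ¬ (q ≡ 0 × s ≡ 4F) → Bounded (blow-up (q * 7 + toℕ s)) (q * 3 + quota s)
  bounded-blow-up 0 s ≢4 = bounded-base s λ s≡4 → ≢4 (refl , s≡4)
  bounded-blow-up 1 s _ with s Fin.≟ 4F
  ... | yes refl = bounded-11
  ... | no s≢4 = bounded-7+ (bounded-blow-up 0 s (s≢4 ∘ proj₂))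
  bounded-blow-up (2+ q) s _ = bounded-7+ (bounded-blow-up (suc q) s λ ())

  upper-bound : ∀ q s → ∃[ c ] (Forb (q * 7 + toℕ s) rrr-bbr-yyb c × Bounded c (q * 3 + quota s))
  upper-bound q s with q ≟ 0 ×-dec s Fin.≟ 4F
  ... | no ≢4 = blow-up (q * 7 + toℕ s) , blow-up-forb (q * 7 + toℕ s) , bounded-blow-up q s ≢4
  ... | yes (refl , refl) = K₄-colouring , allowed⇒forb K₄-colouring K₄-allowed , bounded-K₄

  -- The lower bound, applied to the extremal colouring itself, supplies a set attaining its
  -- maximum; applied to any other colouring, it gives minimality.
  h₂-value : ∀ q s → h₂[_,_]≡_ (q * 7 + toℕ s) rrr-bbr-yyb (q * 3 + quota s)
  h₂-value q s with upper-bound q s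
  ... | c , forb , bound with lower-bound q s c forb
  ...   | e , S , large , avoids =
    (c , forb , (S , ≤-antisym (bound e S avoids) large , avoids⇒two-colours c e avoids) , bounded-size) , minimal
    where
    bounded-size : ∀ k → ∃[ S ] (∣ S ∣ ≡ k × AtMostTwoColours c S) → k ≤ q * 3 + quota s
    bounded-size _ (S , refl , two) with e , avoids ← two-colours⇒avoids c two = bound e S avoids

    minimal : ∀ k → ∃[ c ] (Forb (q * 7 + toℕ s) rrr-bbr-yyb c × h₂[ c ]≡ k) → q * 3 + quota s ≤ k
    minimal k (c , forb , _ , maximal) with e , S , large , avoids ← lower-bound q s c forb =
      ≤-trans large (maximal ∣ S ∣ (S , refl , avoids⇒two-colours c e avoids))

lemma3p22 : (n : ℕ) .{{_ : NonZero n}} →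
    h₂[ n , rrr-bbr-yyb ]≡ (⌈ 3 * n / 7 ⌉ + ε₁ n)
lemma3p22 n with n divMod 7
... | result q s n≡ = subst (λ n → h₂[ n , rrr-bbr-yyb ]≡ (⌈ 3 * n / 7 ⌉ + ε₁ n))
  (sym (trans n≡ (+-comm (toℕ s) (q * 7))))
  (subst (h₂[ q * 7 + toℕ s , rrr-bbr-yyb ]≡_) (sym (closed-form q s)) (h₂-value q s))
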